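{- Let $\tau\ge1$, $\sigma=(\sigma_1,\dots,\sigma_\tau)\in\mathbb{Z}_{\ge1}^\tau$, and define $S:=\prod_{i=1}^\tau(\sigma_i+1)$. (i) Let $\mathcal{A}\in\mathbb{Z}^{S\times(S-1)}$ be bi-diagonal. Then, up to a permutation of its columns, $\mathcal{A}$ is a multi-stage matrix with $\tau$ stages and stage sizes $\sigma$. (ii) Let $\mathcal{A}\in\mathbb{Z}^{2S\times(2S-2)}$ be tri-diagonal. Then, up to a permutation of its columns, $\mathcal{A}$ is a multi-stage matrix with $\tau$ stages and stage sizes $2\sigma=(2\sigma_1,\dots,2\sigma_\tau)$.
   Context: A matrix $\mathcal{A}=(a_{i,j})\in\mathbb{Z}^{m\times n}$ is bi-diagonal if $a_{i,j}=0$ whenever $i\notin\{j,j+1\}$, and tri-diagonal if $a_{i,j}=0$ whenever $i\notin\{j,j+1,j+2\}$. Tree-fold matrices (recursive definition): any matrix $A\in\mathbb{Z}^{m\times n}$ is a tree-fold matrix with one level and level size $m$. A matrix $A$ is a tree-fold matrix with $\tau\ge 2$ levels and level sizes $\sigma=(\sigma_1,\dots,\sigma_\tau)\in\mathbb{Z}_{\ge1}^\tau$ if deleting the first $\sigma_1$ rows of $A$ decomposes the matrix into a block-diagonal matrix, where each (not necessarily square) block is a tree-fold matrix with $\tau-1$ levels and level sizes $(\sigma_2,\dots,\sigma_\tau)$. Multi-stage matrices: $A$ is a multi-stage matrix with $\tau$ stages and stage sizes $\sigma$ if $A^\intercal$ is a tree-fold matrix with $\tau$ levels and level sizes $\sigma$.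 -}

module Defs where

open import Data.Fin.Base using (Fin; toℕ; _↑ˡ_; _↑ʳ_)
open import Data.Fin.Permutation using (Permutation′; _⟨$⟩ʳ_)
open import Data.Integer.Base using (ℤ; 0ℤ)
open import Data.List.Base using (List; []; _∷_)
open import Data.List.Membership.Propositional using (_∉_)
open import Data.Nat.Base using (ℕ; suc; _+_; _*_; _≤_)
open import Data.Product.Base using (∃-syntax)
open import Data.Vec.Base as Vec using (Vec; []; _∷_)
open import Data.Vec.Functional using (Vector; map; take; drop; rearrange; transpose)
open import Relation.Binary.PropositionalEquality using (_≡_)

Matrix : ℕ → ℕ → Set
Matrix m n = Vector (Vector ℤ n) m

BiDiagonal : ∀ {m n} → Matrix m n → Set
BiDiagonal {m} {n} A = ∀ (i : Fin m) (j : Fin n) →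
  toℕ i ∉ (toℕ j ∷ 1 + toℕ j ∷ []) → A i j ≡ 0ℤ

TriDiagonal : ∀ {m n} → Matrix m n → Set
TriDiagonal {m} {n} A = ∀ (i : Fin m) (j : Fin n) →
  toℕ i ∉ (toℕ j ∷ 1 + toℕ j ∷ 2 + toℕ j ∷ []) → A i j ≡ 0ℤ

-- A is block-diagonal with at least one diagonal block, and every diagonal
-- block satisfies P.
data BlockDiagonal (P : ∀ {m n} → Matrix m n → Set) :
                   ∀ {m n} → Matrix m n → Set where
  single : ∀ {m n} {A : Matrix m n} → P A → BlockDiagonal P A
  cons   : ∀ {m₁ m₂ n₁ n₂} {A : Matrix (m₁ + m₂) (n₁ + n₂)} →
           P (map (take n₁ {n₂}) (take m₁ {m₂} A)) →
           (∀ (i : Fin m₁) (j : Fin n₂) → A (i ↑ˡ m₂) (n₁ ↑ʳ j) ≡ 0ℤ) →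
           (∀ (i : Fin m₂) (j : Fin n₁) → A (m₁ ↑ʳ i) (j ↑ˡ n₂) ≡ 0ℤ) →
           BlockDiagonal P (map (drop n₁ {n₂}) (drop m₁ {m₂} A)) →
           BlockDiagonal P A

-- Matrices, in particular the diagonal blocks, are understood to have at least
-- one row and one column.  Requiring this for one level implies it for all.
-- No matrix is tree-fold with zero levels, so in `step` the vector σ is
-- necessarily nonempty.
data TreeFold : ∀ {τ m n} → Vec ℕ τ → Matrix m n → Set where
  one  : ∀ {m n} {A : Matrix m n} → 1 ≤ m → 1 ≤ n → TreeFold (m ∷ []) A
  step : ∀ {τ s r n} {σ : Vec ℕ τ} {A : Matrix (s + r) n} → 1 ≤ s →
         BlockDiagonal (TreeFold σ) (drop s {r} A) → TreeFold (s ∷ σ) A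

MultiStage : ∀ {τ m n} → Vec ℕ τ → Matrix m n → Set
MultiStage σ A = TreeFold σ (transpose A)

permuteColumns : ∀ {m n} → Permutation′ n → Matrix m n → Matrix m n
permuteColumns π = map (rearrange (π ⟨$⟩ʳ_))

MultiStageUpToColumns : ∀ {τ m n} → Vec ℕ τ → Matrix m n → Set
MultiStageUpToColumns {n = n} σ A =
  ∃[ π ] MultiStage σ (permuteColumns {n = n} π A)

∏[1+_] : ∀ {τ} → Vec ℕ τ → ℕ
∏[1+ σ ] = Vec.foldr′ _*_ 1 (Vec.map suc σ)

{-# OPTIONS --safe #-}
-- Both parts are the case w = 1, 2 of one statement about the transpose B, a
-- (wS − w) × wS matrix whose row i is supported on the columns i, …, i + w.
-- Write S = (s + 1) S' with s the first level size.  Moving the rows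
-- wS' − w, …, wS' − 1 of each of the first s groups of wS' rows to the top
-- leaves s + 1 diagonal blocks, each of the same shape with S' in place of S.
-- The required row order depends only on w and σ, so it suffices to track the
-- position ℓ i that row i had in the band matrix.
module Submission where

open import Defs
open import Data.Fin.Base using (Fin; toℕ; _↑ˡ_; _↑ʳ_)
open import Data.Fin.Permutation as Perm using (Permutation′; _⟨$⟩ʳ_; ↔⇒≡)
open import Data.Fin.Properties
  using (+↔⊎; splitAt-↑ˡ; splitAt-↑ʳ; toℕ-↑ˡ; toℕ-↑ʳ; toℕ<n)
open import Data.Integer.Base using (0ℤ)
open import Data.List.Relation.Unary.Any using (here; there)
open import Data.Nat.Base using (ℕ; zero; suc; _+_; _*_; _∸_; _≤_; _<_; z≤n; s≤s)
open import Data.Nat.Properties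
open import Data.Product.Base using (Σ-syntax; _×_; _,_)
open import Data.Sum.Base using (_⊎_; inj₁; inj₂)
open import Data.Sum.Function.Propositional using (_⊎-↔_)
open import Data.Vec.Base using (Vec; []; _∷_; map)
open import Data.Vec.Functional using (transpose)
open import Data.Vec.Properties using (map-cong; map-id)
open import Data.Vec.Relation.Unary.All using (All; []; _∷_)
open import Function.Base using (_∘_)
open import Function.Bundles using (_↔_; mk↔ₛ′; Inverse)
open import Function.Construct.Composition using (_↔-∘_)
open import Function.Construct.Identity using (↔-id)
open import Function.Construct.Symmetry using (↔-sym)
open import Relation.Binary.PropositionalEquality
open import Relation.Nullary using (¬_)

Banded : ∀ {m n} → ℕ → (Fin m → ℕ) → Matrix m n → Set
Banded w ℓ B = ∀ i j → ¬ (ℓ i ≤ toℕ j × toℕ j ≤ ℓ i + w) → B i j ≡ 0ℤ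

-- From listing order to position order: `A` and `B` are the first and the later separating rows,
-- `C` and `D` the rows of the first and of the later blocks. In the band matrix `C` comes first,
-- then `A`, then `B` and `D` together.
⊎-interchange : ∀ {A B C D : Set} → ((A ⊎ B) ⊎ (C ⊎ D)) ↔ (C ⊎ (A ⊎ (B ⊎ D)))
⊎-interchange = mk↔ₛ′
  (λ { (inj₁ (inj₁ a)) → inj₂ (inj₁ a)
     ; (inj₁ (inj₂ b)) → inj₂ (inj₂ (inj₁ b))
     ; (inj₂ (inj₁ c)) → inj₁ c
     ; (inj₂ (inj₂ d)) → inj₂ (inj₂ (inj₂ d)) })
  (λ { (inj₁ c) → inj₂ (inj₁ c)
     ; (inj₂ (inj₁ a)) → inj₁ (inj₁ a)
     ; (inj₂ (inj₂ (inj₁ b))) → inj₁ (inj₂ b)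
     ; (inj₂ (inj₂ (inj₂ d))) → inj₂ (inj₂ d) })
  (λ { (inj₁ _) → refl
     ; (inj₂ (inj₁ _)) → refl
     ; (inj₂ (inj₂ (inj₁ _))) → refl
     ; (inj₂ (inj₂ (inj₂ _))) → refl })
  (λ { (inj₁ (inj₁ _)) → refl
     ; (inj₁ (inj₂ _)) → refl
     ; (inj₂ (inj₁ _)) → refl
     ; (inj₂ (inj₂ _)) → refl })

-- All diagonal blocks have the same shape, so one `π`, fixed before `B`, serves each of them. In
-- use `P` is `TreeFold` for the remaining levels and `n` is wS'.
module _ (P : ∀ {m n} → Matrix m n → Set) {w m n : ℕ} (m+w≡n : m + w ≡ n)
         (π : Permutation′ m)
         (block : ∀ (B : Matrix m n) → Banded w (toℕ ∘ (π ⟨$⟩ʳ_)) B → P B)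
         where

  -- The summand Fin (s * w) lists the separating rows, Fin r the remaining ones.
  BlockOrder : ℕ → ℕ → ℕ → Set
  BlockOrder s M N = Σ[ r ∈ ℕ ] Σ[ φ ∈ (Fin (s * w) ⊎ Fin r) ↔ Fin M ]
    ∀ (B : Matrix r N) → Banded w (toℕ ∘ Inverse.to φ ∘ inj₂) B → BlockDiagonal P B

  -- Rows at positions below `m` end before column `m + w` = `n`; rows from position `m + w` on
  -- start at column `n` or later. So both off-diagonal parts vanish, and only the `w` rows in
  -- between, which become separating rows, can straddle the cut.
  prependBlock : ∀ {s M N} → BlockOrder s M N → BlockOrder (suc s) (m + (w + M)) (n + N)
  prependBlock {s} {M} {N} (r , φ , blocks) = m + r , ψ , λ B banded →
    cons
      (block _ λ i j out → banded (i ↑ˡ r) (j ↑ˡ N)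
        (out ∘ subst₂ (λ l c → l ≤ c × c ≤ l + w) (ψ-first i) (toℕ-↑ˡ j N)))
      (λ i j → banded (i ↑ˡ r) (n ↑ʳ j) λ (_ , c≤) →
        <⇒≱ (first-below i j) (subst₂ (λ l c → c ≤ l + w) (ψ-first i) (toℕ-↑ʳ n j) c≤))
      (λ i j → banded (m ↑ʳ i) (j ↑ˡ N) λ (l≤ , _) →
        <⇒≱ (≤-trans (toℕ<n j) (m≤m+n n _))
            (subst₂ _≤_ (ψ-rest i) (toℕ-↑ˡ j N) l≤))
      (blocks _ λ i j out → banded (m ↑ʳ i) (n ↑ʳ j)
        (out ∘ unshift ∘ subst₂ (λ l c → l ≤ c × c ≤ l + w) (ψ-rest i) (toℕ-↑ʳ n j)))
    where
    ψ : (Fin (suc s * w) ⊎ Fin (m + r)) ↔ Fin (m + (w + M))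
    ψ = ↔-sym +↔⊎ ↔-∘ ((π ⊎-↔ (↔-sym +↔⊎ ↔-∘ (↔-id _ ⊎-↔ φ)))
          ↔-∘ (⊎-interchange ↔-∘ (+↔⊎ ⊎-↔ +↔⊎)))

    ψ-first : ∀ i → toℕ (Inverse.to ψ (inj₂ (i ↑ˡ r))) ≡ toℕ (π ⟨$⟩ʳ i)
    ψ-first i rewrite splitAt-↑ˡ m i r = toℕ-↑ˡ (π ⟨$⟩ʳ i) (w + M)

    ψ-rest : ∀ i → toℕ (Inverse.to ψ (inj₂ (m ↑ʳ i))) ≡ n + toℕ (Inverse.to φ (inj₂ i))
    ψ-rest i rewrite splitAt-↑ʳ m r i = begin
      toℕ (m ↑ʳ (w ↑ʳ k))  ≡⟨ toℕ-↑ʳ m (w ↑ʳ k) ⟩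
      m + toℕ (w ↑ʳ k)     ≡⟨ cong (m +_) (toℕ-↑ʳ w k) ⟩
      m + (w + toℕ k)      ≡⟨ +-assoc m w (toℕ k) ⟨
      m + w + toℕ k        ≡⟨ cong (_+ toℕ k) m+w≡n ⟩
      n + toℕ k            ∎
      where
      open ≡-Reasoning
      k = Inverse.to φ (inj₂ i)

    first-below : ∀ i (j : Fin N) → toℕ (π ⟨$⟩ʳ i) + w < n + toℕ j
    first-below i j = ≤-trans
      (subst (toℕ (π ⟨$⟩ʳ i) + w <_) m+w≡n (+-monoˡ-< w (toℕ<n (π ⟨$⟩ʳ i))))
      (m≤m+n n (toℕ j))

    unshift : ∀ {l c} → n + l ≤ n + c × n + c ≤ n + l + w → l ≤ c × c ≤ l + w
    unshift {l} {c} (l≤c , c≤l+w) =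
      +-cancelˡ-≤ n l c l≤c , +-cancelˡ-≤ n c (l + w) (subst (n + c ≤_) (+-assoc n l w) c≤l+w)

  -- Separating rows sit only between consecutive blocks, so `suc s` blocks have `s * w` of them and
  -- (s + 1)m + sw = N - w rows in all. Peeling off one block and the `w` rows after it preserves
  -- this relation.
  blockOrder : ∀ s {M N} → M + w ≡ N → N ≡ suc s * n → BlockOrder s M N
  -- The last block has no separating rows after it: `Fin (0 * w)` is empty and `π` alone gives the
  -- order.
  blockOrder zero {M} {N} M+w≡N N≡ with trans N≡ (+-identityʳ n)
  ... | refl with +-cancelʳ-≡ w M m (trans M+w≡N (sym m+w≡n))
  ... | refl = m , π ↔-∘ mk↔ₛ′ (λ { (inj₂ i) → i ; (inj₁ ()) }) inj₂ (λ _ → refl) (λ { (inj₂ _) → refl ; (inj₁ ()) })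
             , λ B banded → single (block B banded)
  blockOrder (suc s) {M} {N} M+w≡N refl =
    subst (λ K → BlockOrder (suc s) K N) (sym M≡)
      (prependBlock {s = s} (blockOrder s (m∸n+n≡m w≤) refl))
    where
    open ≡-Reasoning
    rest = suc s * n

    w≤ : w ≤ rest
    w≤ = ≤-trans (≤-trans (m≤n+m w m) (≤-reflexive m+w≡n)) (m≤m+n n (s * n))

    M≡ : M ≡ m + (w + (rest ∸ w))
    M≡ = +-cancelʳ-≡ w M _ (begin
      M + w                       ≡⟨ M+w≡N ⟩
      n + rest                    ≡⟨ cong₂ _+_ m+w≡n (m+[n∸m]≡n w≤) ⟨
      m + w + (w + (rest ∸ w))    ≡⟨ +-assoc m w _ ⟩
      m + (w + (w + (rest ∸ w)))  ≡⟨ cong (m +_) (+-comm w _) ⟩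
      m + (w + (rest ∸ w) + w)    ≡⟨ +-assoc m _ w ⟨
      m + (w + (rest ∸ w)) + w    ∎)

treeFoldStep : ∀ {τ q r m n w} {σ : Vec ℕ τ} → 1 ≤ q → (φ : (Fin q ⊎ Fin r) ↔ Fin m) →
  (∀ (B : Matrix r n) → Banded w (toℕ ∘ Inverse.to φ ∘ inj₂) B →
    BlockDiagonal (TreeFold σ) B) →
  Σ[ π ∈ Permutation′ m ]
    ∀ (B : Matrix m n) → Banded w (toℕ ∘ (π ⟨$⟩ʳ_)) B → TreeFold (q ∷ σ) B
-- The bijection forces `q + r ≡ m`; this makes it a permutation with the separating rows on top and
-- gives `B` the shape that `step` expects.
treeFoldStep {q = q} {r} {w = w} 1≤q φ blocks with ↔⇒≡ (φ ↔-∘ +↔⊎)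
... | refl = φ ↔-∘ +↔⊎ , λ B banded → step 1≤q (blocks _ λ i j out →
  banded (q ↑ʳ i) j (out ∘ subst (λ x → toℕ (Inverse.to φ x) ≤ toℕ j
                                        × toℕ j ≤ toℕ (Inverse.to φ x) + w)
                                 (splitAt-↑ʳ q r i)))

∏[1+]-positive : ∀ {τ} (σ : Vec ℕ τ) → 1 ≤ ∏[1+ σ ]
∏[1+]-positive []      = ≤-refl
∏[1+]-positive (k ∷ σ) = *-mono-≤ {1} {suc k} (s≤s z≤n) (∏[1+]-positive σ)

-- Induction on `σ`. The sizes are tied to `σ` by equations only, so that for `w` = 1 the column
-- count can be S itself rather than `1 * S`.
treeFoldOrder : ∀ {τ} w → 1 ≤ w → 1 ≤ τ → (σ : Vec ℕ τ) → All (1 ≤_) σ →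
  ∀ {m n} → m + w ≡ n → n ≡ w * ∏[1+ σ ] →
  Σ[ π ∈ Permutation′ m ]
    ∀ (B : Matrix m n) → Banded w (toℕ ∘ (π ⟨$⟩ʳ_)) B → TreeFold (map (w *_) σ) B
-- One level asks for a nonempty matrix with the right number of rows, and w(s + 1) - w = ws.
treeFoldOrder w 1≤w _ (s ∷ []) (1≤s ∷ []) {m} {n} m+w≡n n≡ =
  Perm.id , λ B _ → subst (λ k → TreeFold (k ∷ []) B) m≡ws
    (one (subst (1 ≤_) (sym m≡ws) (*-mono-≤ 1≤w 1≤s))
         (subst (1 ≤_) m+w≡n (≤-trans 1≤w (m≤n+m w m))))
  where
  open ≡-Reasoning
  m≡ws : m ≡ w * s
  m≡ws = +-cancelˡ-≡ w m (w * s) (begin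
    w + m            ≡⟨ +-comm w m ⟩
    m + w            ≡⟨ m+w≡n ⟩
    n                ≡⟨ n≡ ⟩
    w * (suc s * 1)  ≡⟨ cong (w *_) (*-identityʳ (suc s)) ⟩
    w * suc s        ≡⟨ *-suc w s ⟩
    w + w * s        ∎)
treeFoldOrder w 1≤w _ (s ∷ σ@(_ ∷ _)) (1≤s ∷ 1≤σ) {m} {n} m+w≡n n≡ =
  let π , treeFold   = treeFoldOrder w 1≤w (s≤s z≤n) σ 1≤σ rest+w≡ refl
      r , φ , blocks = blockOrder (TreeFold (map (w *_) σ)) rest+w≡ π treeFold s m+w≡n n≡′
  -- Separating rows are counted as `s` groups of `w`, while the level size reads `w * s`.
  in subst (λ q → Σ[ π ∈ Permutation′ m ] ∀ (B : Matrix m n) →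
                    Banded w (toℕ ∘ (π ⟨$⟩ʳ_)) B → TreeFold (q ∷ map (w *_) σ) B)
       (*-comm s w) (treeFoldStep (*-mono-≤ 1≤s 1≤w) φ blocks)
  where
  open ≡-Reasoning
  S′ = ∏[1+ σ ]

  rest+w≡ : w * S′ ∸ w + w ≡ w * S′
  rest+w≡ = m∸n+n≡m (subst (_≤ w * S′) (*-identityʳ w) (*-monoʳ-≤ w (∏[1+]-positive σ)))

  n≡′ : n ≡ suc s * (w * S′)
  n≡′ = begin
    n                 ≡⟨ n≡ ⟩
    w * (suc s * S′)  ≡⟨ *-assoc w (suc s) S′ ⟨
    w * suc s * S′    ≡⟨ cong (_* S′) (*-comm w (suc s)) ⟩
    suc s * w * S′    ≡⟨ *-assoc (suc s) w S′ ⟩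
    suc s * (w * S′)  ∎

offset-within : ∀ {l c w} d → d ≤ w → c ≡ d + l → l ≤ c × c ≤ l + w
offset-within {l} {w = w} d d≤w refl =
  m≤n+m l d , subst (_≤ l + w) (+-comm l d) (+-monoʳ-≤ l d≤w)

-- Row `j` of the transpose is column `π ⟨$⟩ʳ j` of `A`, so this index is its position; the allowed
-- entries lie at offsets 0 and 1 from it.
biDiagonal-banded : ∀ {m n} {A : Matrix m n} → BiDiagonal A → (π : Permutation′ n) →
  Banded 1 (toℕ ∘ (π ⟨$⟩ʳ_)) (transpose (permuteColumns π A))
biDiagonal-banded bi π j i out = bi i (π ⟨$⟩ʳ j) λ
  { (here i≡)         → out (offset-within 0 z≤n i≡)
  ; (there (here i≡)) → out (offset-within 1 ≤-refl i≡) }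

triDiagonal-banded : ∀ {m n} {A : Matrix m n} → TriDiagonal A → (π : Permutation′ n) →
  Banded 2 (toℕ ∘ (π ⟨$⟩ʳ_)) (transpose (permuteColumns π A))
triDiagonal-banded tri π j i out = tri i (π ⟨$⟩ʳ j) λ
  { (here i≡)                 → out (offset-within 0 z≤n i≡)
  ; (there (here i≡))         → out (offset-within 1 (s≤s z≤n) i≡)
  ; (there (there (here i≡))) → out (offset-within 2 ≤-refl i≡) }

lemma1 : ∀ (τ : ℕ) → 1 ≤ τ → (σ : Vec ℕ τ) → All (1 ≤_) σ →
    let S = ∏[1+ σ ] in
    ((A : Matrix S (S ∸ 1)) → BiDiagonal A →
    MultiStageUpToColumns σ A)
    ×
    ((A : Matrix (2 * S) (2 * S ∸ 2)) → TriDiagonal A →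
    MultiStageUpToColumns (map (2 *_) σ) A)
lemma1 τ 1≤τ σ 1≤σ = bi , tri
  where
  S = ∏[1+ σ ]

  bi : (A : Matrix S (S ∸ 1)) → BiDiagonal A → MultiStageUpToColumns σ A
  bi A biA =
    let π , treeFold = treeFoldOrder 1 ≤-refl 1≤τ σ 1≤σ
                         (m∸n+n≡m (∏[1+]-positive σ)) (sym (*-identityˡ S))
    -- For `w` = 1 the level sizes arrive as `map (1 *_) σ`.
    in π , subst (λ ρ → MultiStage ρ (permuteColumns π A))
             (trans (map-cong *-identityˡ σ) (map-id σ))
             (treeFold _ (biDiagonal-banded biA π))

  tri : (A : Matrix (2 * S) (2 * S ∸ 2)) → TriDiagonal A →
    MultiStageUpToColumns (map (2 *_) σ) A
  tri A triA =
    let π , treeFold = treeFoldOrder 2 (s≤s z≤n) 1≤τ σ 1≤σ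
                         (m∸n+n≡m (*-monoʳ-≤ 2 (∏[1+]-positive σ))) refl
    in π , treeFold _ (triDiagonal-banded triA π)
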